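{- Let $G$ be a finite simple graph without isolated vertices. If $\gamma_{Zg}(G)$ is an even number, then $\gamma_{Zg}(G)+1\le\gamma_{Lg}(G)$.
   Context: Graphs are finite and simple (and nonempty). $N(v)$ and $N[v]=N(v)\cup\{v\}$ denote the open and closed neighborhood of a vertex $v$. Games: two players, Dominator and Staller, alternately select vertices $v_1,v_2,\ldots$ of an isolate-free graph $G$. The $i$-th move $v_i$ is legal: - in the Z-domination game, if $N(v_i)\setminus\bigcup_{j=1}^{i-1}N[v_j]\neq\emptyset$; - in the L-domination game, if $N[v_i]\setminus\bigcup_{j=1}^{i-1}N(v_j)\neq\emptyset$ and $v_i\neq v_j$ for all $j<i$. Each game ends when no legal move is available. Dominator wants to minimize the total number of moves, Staller wants to maximize it. When Dominator moves first and both players play optimally, the total number of moves played (by both players) is $\gamma_{Zg}(G)$ in the Z-domination game and $\gamma_{Lg}(G)$ in the L-domination game. -}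

module Defs where

open import Level using (0ℓ)
open import Data.Nat using (ℕ; zero; suc; _+_; _≤_; _⊓_; _⊔_)
import Data.Nat.Properties as ℕ
open import Data.Fin using (Fin; zero; suc; _≟_)
open import Data.Fin.Properties using (injective⇒≤)
open import Data.Fin.Subset using (Subset; ⁅_⁆; _∪_; _─_; ⋃; Nonempty; inside; outside)
import Data.Fin.Subset as Subset
import Data.Fin.Subset.Properties as Subset
open import Data.Vec using (tabulate; _∷_; there)
open import Data.List using (List; []; _∷_; map; filter; foldr; allFin; length; lookup)
open import Data.List.Properties using (filter-none; map-cong-local)
open import Data.List.Membership.Propositional using (_∈_; _∉_)
open import Data.List.Membership.Propositional.Properties using (∈-lookup)
import Data.List.Membership.DecPropositional as DecMembership
open import Data.List.Relation.Unary.Any using (here; there)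
open import Data.List.Relation.Unary.All as All using ()
open import Data.List.Relation.Unary.All.Properties using (all-filter; ¬Any⇒All¬)
open import Data.List.Relation.Unary.AllPairs using ([]; _∷_)
open import Data.List.Relation.Unary.Unique.Propositional using (Unique)
open import Data.Product using (_×_; _,_; proj₂)
open import Relation.Binary using (Rel; Decidable; Symmetric; Irreflexive)
open import Relation.Binary.PropositionalEquality using (_≡_; refl; sym; trans; cong; subst)
open import Relation.Nullary using (Dec; does; contradiction; ¬?; _×-dec_)

record Graph (n : ℕ) : Set₁ where
  field
    Adj        : Rel (Fin n) 0ℓ
    adj?       : Decidable Adj
    adj-sym    : Symmetric Adj
    adj-irrefl : Irreflexive _≡_ Adj

  N : Fin n → Subset n
  N v = tabulate (λ u → does (adj? v u))

  N[_] : Fin n → Subset n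
  N[ v ] = N v ∪ ⁅ v ⁆

IsolateFree : ∀ {n} → Graph n → Set
IsolateFree {n} G = (v : Fin n) → Nonempty (Graph.N G v)

data Player : Set where
  Dominator Staller : Player

opponent : Player → Player
opponent Dominator = Staller
opponent Staller   = Dominator

-- The list holds, for each legal move of the player on turn, the number of
-- moves that follow it; the result also counts the move itself. With no legal
-- move the game is over.
best : Player → List ℕ → ℕ
best _         []       = 0
best Dominator (k ∷ ks) = suc (foldr _⊓_ k ks)
best Staller   (k ∷ ks) = suc (foldr _⊔_ k ks)

private
  lookup-injective : ∀ {A : Set} {xs : List A} → Unique xs →
                     ∀ {i j} → lookup xs i ≡ lookup xs j → i ≡ j
  lookup-injective (_  ∷ _) {zero}  {zero}  _  = refl
  lookup-injective (x∉ ∷ _) {zero}  {suc j} eq =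
    contradiction eq (All.lookup x∉ (∈-lookup j))
  lookup-injective (x∉ ∷ _) {suc i} {zero}  eq =
    contradiction (sym eq) (All.lookup x∉ (∈-lookup i))
  lookup-injective (_  ∷ u) {suc i} {suc j} eq = cong suc (lookup-injective u eq)

  unique⇒length≤ : ∀ {n} {h : List (Fin n)} → Unique h → length h ≤ n
  unique⇒length≤ {h = h} u = injective⇒≤ {f = lookup h} (lookup-injective u)

-- A position is the list of the vertices played so far, latest first.
module Game {n : ℕ} {Legal : List (Fin n) → Fin n → Set}
            (legal? : ∀ h v → Dec (Legal h v)) where

  -- Optimal play from position h, cut off after the given number of moves.
  truncated : ℕ → Player → List (Fin n) → ℕ
  truncated zero    _ _ = 0
  truncated (suc f) p h =
    best p (map (λ v → truncated f (opponent p) (v ∷ h))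
                (filter (legal? h) (allFin n)))

  -- In a game where no vertex can be played twice, the cut-off after n moves
  -- is never felt: value-unfold is the minimax recursion without it.
  value : Player → List (Fin n) → ℕ
  value = truncated n

  module _ (fresh : ∀ {h v} → Legal h v → v ∉ h) where

    private
      extend : ∀ {h v} → Unique h → Legal h v → Unique (v ∷ h)
      extend u l = ¬Any⇒All¬ _ (fresh l) ∷ u

      truncated-stable : ∀ f p h → Unique h → n ≤ length h + f →
                         truncated f p h ≡ truncated (suc f) p h
      truncated-stable zero p h u n≤ = sym (cong (λ vs → best p (map _ vs))
        (filter-none (legal? h) {xs = allFin n} (All.universal (λ v l →
          ℕ.<⇒≱ (unique⇒length≤ (extend u l))
                (subst (n ≤_) (ℕ.+-identityʳ (length h)) n≤)) (allFin n))))
      truncated-stable (suc f) p h u n≤ = cong (best p) (map-cong-local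
        (All.map (λ {v} l → truncated-stable f (opponent p) (v ∷ h) (extend u l)
                              (subst (n ≤_) (ℕ.+-suc (length h) f) n≤))
                 (all-filter (legal? h) (allFin n))))

    value-unfold : ∀ p h → Unique h →
      value p h ≡ best p (map (λ v → value (opponent p) (v ∷ h))
                              (filter (legal? h) (allFin n)))
    value-unfold p h u = truncated-stable n p h u (ℕ.m≤n+m n (length h))

module _ {n : ℕ} (G : Graph n) where
  open Graph G
  open DecMembership (_≟_ {n}) using (_∈?_)

  ZLegal : List (Fin n) → Fin n → Set
  ZLegal h v = Nonempty (N v ─ ⋃ (map N[_] h))

  LLegal : List (Fin n) → Fin n → Set
  LLegal h v = Nonempty (N[ v ] ─ ⋃ (map N h)) × v ∉ h

  zLegal? : ∀ h v → Dec (ZLegal h v)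
  zLegal? h v = Subset.nonempty? (N v ─ ⋃ (map N[_] h))

  lLegal? : ∀ h v → Dec (LLegal h v)
  lLegal? h v = Subset.nonempty? (N[ v ] ─ ⋃ (map N h)) ×-dec ¬? (v ∈? h)

  γZg : ℕ
  γZg = Game.value zLegal? Dominator []

  γLg : ℕ
  γLg = Game.value lLegal? Dominator []

  private
    ∈─⇒∉ : ∀ {m} {x : Fin m} (p q : Subset m) → x Subset.∈ p ─ q → x Subset.∉ q
    ∈─⇒∉ (_ ∷ p) (outside ∷ q) (there x∈) (there x∈q) = ∈─⇒∉ p q x∈ x∈q
    ∈─⇒∉ (_ ∷ p) (inside  ∷ q) (there x∈) (there x∈q) = ∈─⇒∉ p q x∈ x∈q

    N⊆⋃N[] : ∀ {h v x} → v ∈ h → x Subset.∈ N v → x Subset.∈ ⋃ (map N[_] h)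
    N⊆⋃N[] {v = v} (here refl) x∈ = Subset.p⊆p∪q _ (Subset.p⊆p∪q ⁅ v ⁆ x∈)
    N⊆⋃N[] (there v∈)          x∈ = Subset.q⊆p∪q _ _ (N⊆⋃N[] v∈ x∈)

  zFresh : ∀ {h v} → ZLegal h v → v ∉ h
  zFresh {h} {v} (x , x∈) v∈h =
    ∈─⇒∉ (N v) (⋃ (map N[_] h)) x∈ (N⊆⋃N[] v∈h (Subset.p─q⊆p _ _ x∈))

  lFresh : ∀ {h v} → LLegal h v → v ∉ h
  lFresh = proj₂

{-# OPTIONS --safe #-}

-- Staller plays the L-game while imagining a Z-game in which he follows an
-- optimal strategy. Throughout, the vertices played in the L-game and their
-- neighbours are dominated in the Z-game, so his Z-moves are legal in the
-- L-game. When a move v of Dominator is illegal in the Z-game, all of N(v) is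
-- dominated there, and Staller lets the imagined Dominator play a neighbour of
-- v, or anything if v is dominated already. As γ_Zg is even, move number γ_Zg
-- is Staller's; instead of copying it he plays in the L-game a vertex x not yet
-- dominated in the Z-game. No neighbour of x has been played, so x is not
-- totally dominated and another move must follow.
module Submission where

open import Defs
open import Data.Nat using (ℕ; zero; suc; _+_; _*_; _≤_; z≤n; s≤s; NonZero)
import Data.Nat.Properties as ℕ
open import Data.Nat.Divisibility using (_∣_; divides)
open import Data.Fin using (Fin; zero)
open import Data.Fin.Subset using (Subset; inside; outside; _∪_; _─_; ⋃; _∈_; _∉_; _⊆_)
open import Data.Fin.Subset.Properties
  using (_∈?_; ∉⊥; p⊆p∪q; q⊆p∪q; x∈p∪q⁻; x∈⁅x⁆; x∈⁅y⁆⇒x≡y; p─q⊆p; x∈p∧x∉q⇒x∈p─q)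
open import Data.Vec using (_∷_; there)
open import Data.Vec.Properties using (lookup⇒[]=; []=⇒lookup; lookup∘tabulate)
open import Data.List using (List; []; _∷_; map; filter; allFin)
open import Data.List.Properties
  using (foldr-forcesᵇ; foldr-preservesᵇ; foldr-preservesʳ; foldr-preservesᵒ)
import Data.List.Membership.Propositional as List
open import Data.List.Membership.Propositional.Properties
  using (foldr-selective; ∈-allFin; ∈-filter⁺; ∈-filter⁻; ∈-map⁺; ∈-map⁻)
open import Data.List.Relation.Unary.All as All using (All; []; _∷_)
open import Data.List.Relation.Unary.All.Properties using (¬Any⇒All¬; all-filter)
import Data.List.Relation.Unary.All.Properties as All
open import Data.List.Relation.Unary.Any as Any using (here; there)
open import Data.List.Relation.Unary.AllPairs using ([]; _∷_)
open import Data.List.Relation.Unary.Unique.Propositional using (Unique)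
open import Data.Product using (∃; _×_; _,_; proj₂)
open import Data.Sum using (inj₁; inj₂; [_,_])
open import Function using (_∘_; id)
open import Relation.Binary.PropositionalEquality using (_≡_; refl; sym; trans; cong; subst)
open import Relation.Nullary using (Dec; yes; no; does)
open import Relation.Nullary.Decidable using (dec-true; decidable-stable)

-- Membership of `k` rules out the finished game: on the empty list the bound on all entries is
-- vacuous, while `best` is 0.
best-Dominator⁺ : ∀ {c k ks} → k List.∈ ks → All (c ≤_) ks → suc c ≤ best Dominator ks
best-Dominator⁺ {ks = _ ∷ _} _ (c≤k ∷ c≤ks) = s≤s (foldr-preservesᵇ ℕ.⊓-glb c≤k c≤ks)

best-Dominator⁻ : ∀ {c ks} → suc c ≤ best Dominator ks → All (c ≤_) ks
best-Dominator⁻ {ks = k ∷ ks} (s≤s c≤) =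
  ℕ.≤-trans c≤ (foldr-preservesʳ (λ m {n} → ℕ.m≤n⇒o⊓m≤n {n} m) ℕ.≤-refl ks) ∷
  foldr-forcesᵇ (λ m n c≤m⊓n → ℕ.m≤n⊓o⇒m≤n m n c≤m⊓n , ℕ.m≤n⊓o⇒m≤o m n c≤m⊓n) k ks c≤

best-Staller⁺ : ∀ {c k ks} → k List.∈ ks → c ≤ k → suc c ≤ best Staller ks
best-Staller⁺ {ks = l ∷ ks} k∈ c≤k = s≤s (foldr-preservesᵒ
  (λ m n → [ ℕ.m≤n⇒m≤n⊔o n , ℕ.m≤n⇒m≤o⊔n m ]) l ks (Any.toSum (List.lose k∈ c≤k)))

best-Staller⁻ : ∀ {c ks} → suc c ≤ best Staller ks → ∃ λ k → k List.∈ ks × c ≤ k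
best-Staller⁻ {ks = k ∷ ks} (s≤s c≤) with foldr-selective ℕ.⊔-sel k ks
... | inj₁ ≡k = k , here refl , subst (_ ≤_) ≡k c≤
... | inj₂ ∈ks = _ , there ∈ks , c≤

best>0⇒nonempty : ∀ p {c ks} → suc c ≤ best p ks → ∃ λ k → k List.∈ ks
best>0⇒nonempty Dominator {ks = k ∷ _} _ = k , here refl
best>0⇒nonempty Staller   {ks = k ∷ _} _ = k , here refl

module GameValue {n : ℕ} {Legal : List (Fin n) → Fin n → Set}
                 (legal? : ∀ h v → Dec (Legal h v))
                 (fresh : ∀ {h v} → Legal h v → v List.∉ h) where
  open Game legal? using (value; value-unfold)

  unique-∷ : ∀ {h v} → Unique h → Legal h v → Unique (v ∷ h)
  unique-∷ u l = ¬Any⇒All¬ _ (fresh l) ∷ u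

  private
    outcomes : Player → List (Fin n) → List ℕ
    outcomes p h = map (λ v → value (opponent p) (v ∷ h)) (filter (legal? h) (allFin n))

    outcome⁺ : ∀ p {h v} → Legal h v → value (opponent p) (v ∷ h) List.∈ outcomes p h
    outcome⁺ p {h} l = ∈-map⁺ _ (∈-filter⁺ (legal? h) (∈-allFin _) l)

    outcome⁻ : ∀ p {h k} → k List.∈ outcomes p h →
               ∃ λ v → Legal h v × k ≡ value (opponent p) (v ∷ h)
    outcome⁻ p {h} k∈ with v , v∈ , eq ← ∈-map⁻ _ k∈ =
      v , proj₂ (∈-filter⁻ (legal? h) {xs = allFin n} v∈) , eq

    fold : ∀ p {h c} → Unique h → c ≤ best p (outcomes p h) → c ≤ value p h
    fold p {h} u = subst (_ ≤_) (sym (value-unfold fresh p h u))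

    unfold : ∀ p {h c} → Unique h → c ≤ value p h → c ≤ best p (outcomes p h)
    unfold p {h} u = subst (_ ≤_) (value-unfold fresh p h u)

  legal-move : ∀ p {h c} → Unique h → suc c ≤ value p h → ∃ (Legal h)
  legal-move p u c<
    with _ , k∈ ← best>0⇒nonempty p (unfold p u c<)
    with v , l , _ ← outcome⁻ p k∈ = v , l

  value-Dominator⁺ : ∀ {h c} → Unique h → ∃ (Legal h) →
                     (∀ {v} → Legal h v → c ≤ value Staller (v ∷ h)) →
                     suc c ≤ value Dominator h
  value-Dominator⁺ {h} u (_ , l) c≤ = fold Dominator u
    (best-Dominator⁺ (outcome⁺ Dominator l)
                     (All.map⁺ (All.map c≤ (all-filter (legal? h) (allFin n)))))

  value-Dominator⁻ : ∀ {h c v} → Unique h → suc c ≤ value Dominator h → Legal h v →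
                     c ≤ value Staller (v ∷ h)
  value-Dominator⁻ u c< l =
    All.lookup (best-Dominator⁻ (unfold Dominator u c<)) (outcome⁺ Dominator l)

  value-Staller⁺ : ∀ {h c v} → Unique h → Legal h v → c ≤ value Dominator (v ∷ h) →
                   suc c ≤ value Staller h
  value-Staller⁺ u l c≤ = fold Staller u (best-Staller⁺ (outcome⁺ Staller l) c≤)

  value-Staller⁻ : ∀ {h c} → Unique h → suc c ≤ value Staller h →
                   ∃ λ v → Legal h v × c ≤ value Dominator (v ∷ h)
  value-Staller⁻ u c<
    with _ , k∈ , c≤k ← best-Staller⁻ (unfold Staller u c<)
    with v , l , refl ← outcome⁻ Staller k∈ = v , l , c≤k

  value>0 : ∀ p {h v} → Unique h → Legal h v → 1 ≤ value p h
  value>0 Dominator u l = value-Dominator⁺ u (_ , l) (λ _ → z≤n)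
  value>0 Staller   u l = value-Staller⁺ u l z≤n

x∈p─q⇒x∉q : ∀ {m} {x : Fin m} (p q : Subset m) → x ∈ p ─ q → x ∉ q
x∈p─q⇒x∉q (_ ∷ p) (outside ∷ q) (there x∈) (there x∈q) = x∈p─q⇒x∉q p q x∈ x∈q
x∈p─q⇒x∉q (_ ∷ p) (inside  ∷ q) (there x∈) (there x∈q) = x∈p─q⇒x∉q p q x∈ x∈q

∪-lub : ∀ {m} {p q r : Subset m} → p ⊆ r → q ⊆ r → p ∪ q ⊆ r
∪-lub {p = p} {q} p⊆r q⊆r = [ p⊆r , q⊆r ] ∘ x∈p∪q⁻ p q

module _ {n : ℕ} (G : Graph n) where
  open Graph G

  private
    module Z = GameValue (zLegal? G) (zFresh G)
    module L = GameValue (lLegal? G) (lFresh G)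

    zValue lValue : Player → List (Fin n) → ℕ
    zValue = Game.value (zLegal? G)
    lValue = Game.value (lLegal? G)

  dominated totallyDominated : List (Fin n) → Subset n
  dominated h        = ⋃ (map N[_] h)
  totallyDominated h = ⋃ (map N h)

  ∈N⇒Adj : ∀ {v x} → x ∈ N v → Adj v x
  ∈N⇒Adj {v} {x} x∈ with adj? v x | trans (sym (lookup∘tabulate (does ∘ adj? v) x)) ([]=⇒lookup x∈)
  ... | yes a | _  = a
  ... | no  _ | ()

  Adj⇒∈N : ∀ {v x} → Adj v x → x ∈ N v
  Adj⇒∈N {v} {x} a = lookup⇒[]= x _
    (trans (lookup∘tabulate (does ∘ adj? v) x) (dec-true (adj? v x) a))

  N-sym : ∀ {v x} → x ∈ N v → v ∈ N x
  N-sym = Adj⇒∈N ∘ adj-sym ∘ ∈N⇒Adj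

  x∉N[x] : ∀ {x} → x ∉ N x
  x∉N[x] = adj-irrefl refl ∘ ∈N⇒Adj

  ∈⇒N⊆totallyDominated : ∀ {h v} → v List.∈ h → N v ⊆ totallyDominated h
  ∈⇒N⊆totallyDominated (here refl) = p⊆p∪q _
  ∈⇒N⊆totallyDominated (there v∈)  = q⊆p∪q _ _ ∘ ∈⇒N⊆totallyDominated v∈

  ∈⇒∈dominated : ∀ {h v} → v List.∈ h → v ∈ dominated h
  ∈⇒∈dominated (here refl) = p⊆p∪q _ (q⊆p∪q _ _ (x∈⁅x⁆ _))
  ∈⇒∈dominated (there v∈)  = q⊆p∪q _ _ (∈⇒∈dominated v∈)

  totallyDominated⊆dominated : ∀ h → totallyDominated h ⊆ dominated h
  totallyDominated⊆dominated []      = id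
  totallyDominated⊆dominated (v ∷ h) =
    ∪-lub (p⊆p∪q _ ∘ p⊆p∪q _) (q⊆p∪q _ _ ∘ totallyDominated⊆dominated h)

  zLegal⁺ : ∀ h {v x} → x ∈ N v → x ∉ dominated h → ZLegal G h v
  zLegal⁺ _ x∈ x∉ = _ , x∈p∧x∉q⇒x∈p─q x∈ x∉

  zLegal⁻ : ∀ h {v} → ZLegal G h v → ∃ λ x → x ∈ N v × x ∉ dominated h
  zLegal⁻ h {v} (x , x∈) = x , p─q⊆p (N v) (dominated h) x∈ , x∈p─q⇒x∉q (N v) (dominated h) x∈

  -- The vertex `x` serves twice: it is newly totally dominated by `v`, and it shows that `v` is
  -- fresh, since an earlier play of `v` would have totally dominated `x`.
  lLegal-neighbour : ∀ h {v x} → x ∈ N v → x ∉ totallyDominated h → LLegal G h v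
  lLegal-neighbour _ x∈ x∉ =
    (_ , x∈p∧x∉q⇒x∈p─q (p⊆p∪q _ x∈) x∉) , λ v∈h → x∉ (∈⇒N⊆totallyDominated v∈h x∈)

  -- Such an `x` witnesses its own legality as an element of its closed neighbourhood, and it is
  -- fresh because played vertices are dominated.
  lLegal-undominated : ∀ h {x} → x ∉ dominated h → LLegal G h x
  lLegal-undominated h x∉ =
    (_ , x∈p∧x∉q⇒x∈p─q (q⊆p∪q _ _ (x∈⁅x⁆ _)) (x∉ ∘ totallyDominated⊆dominated h)) ,
    x∉ ∘ ∈⇒∈dominated

  N[]⊆dominated : ∀ h {v} → N v ⊆ dominated h → v ∈ dominated h → N[ v ] ⊆ dominated h
  N[]⊆dominated _ {v} N⊆ v∈ = ∪-lub N⊆ λ x∈ → subst (_∈ _) (sym (x∈⁅y⁆⇒x≡y v x∈)) v∈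

  zLegal⇒lLegal : ∀ hZ hL {v} → dominated hL ⊆ dominated hZ → ZLegal G hZ v → LLegal G hL v
  zLegal⇒lLegal hZ hL inv lv with x , x∈ , x∉ ← zLegal⁻ hZ lv =
    lLegal-neighbour hL x∈ (x∉ ∘ inv ∘ totallyDominated⊆dominated hL)

  module _ (isolateFree : IsolateFree G) where

    -- For v legal only in the L-game, this is the move in the Z-game whose
    -- closed neighbourhood makes up for that of v.
    z-substitute : ∀ h v → ∃ (ZLegal G h) →
                   ∃ λ w → ZLegal G h w × N[ v ] ⊆ dominated (w ∷ h)
    z-substitute h v (u , lu) with zLegal? G h v
    ... | yes lv = v , lv , p⊆p∪q _
    ... | no ¬lv with N⊆ ← (λ {x} (x∈ : x ∈ N v) →
                       decidable-stable (x ∈? dominated h) (¬lv ∘ zLegal⁺ h x∈))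
                 with v ∈? dominated h
    ...   | yes v∈ = u , lu , q⊆p∪q _ _ ∘ N[]⊆dominated h N⊆ v∈
    -- The neighbour `w` is legal because it newly dominates `v`, the only vertex of `N[ v ]` that
    -- was still missing.
    ...   | no  v∉ with w , w∈ ← isolateFree v =
      w , zLegal⁺ h (N-sym w∈) v∉ ,
      N[]⊆dominated (w ∷ h) (q⊆p∪q _ _ ∘ N⊆) (p⊆p∪q _ (p⊆p∪q _ (N-sym w∈)))

    -- Staller plays `x`. Open neighbourhoods do not contain their centre, so `x` stays not totally
    -- dominated, and any neighbour of `x` is a legal next move.
    two-more-moves : ∀ {h x} → Unique h → x ∉ dominated h → 2 ≤ lValue Staller h
    two-more-moves {h} {x} u x∉ with y , y∈ ← isolateFree x =
      L.value-Staller⁺ u lx (L.value>0 Dominator (L.unique-∷ u lx)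
        (lLegal-neighbour (x ∷ h) (N-sym y∈)
          ([ x∉N[x] , x∉ ∘ totallyDominated⊆dominated h ] ∘ x∈p∪q⁻ (N x) _)))
      where lx = lLegal-undominated h x∉

    mutual
      -- The induction carries lower bounds on the Z-value, not equalities: the imagined Dominator
      -- may play badly, which can only prolong the Z-game. The L-bound exceeds the Z-bound by the
      -- one move gained at the end.
      dominator-turn : ∀ j {hZ hL} → Unique hZ → Unique hL → dominated hL ⊆ dominated hZ →
                       suc j * 2 ≤ zValue Dominator hZ → suc (suc j * 2) ≤ lValue Dominator hL
      dominator-turn j {hZ} {hL} uZ uL inv c≤
        -- This Z-move has two uses: it shows that the L-game is not over, and it is the arbitrary
        -- move available to `z-substitute`.
        with v , lv ← Z.legal-move Dominator uZ c≤ =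
        L.value-Dominator⁺ uL (v , zLegal⇒lLegal hZ hL inv lv)
          λ {w} lw → reply lw (z-substitute hZ w (v , lv))
        where
        reply : ∀ {w} → LLegal G hL w →
                (∃ λ w′ → ZLegal G hZ w′ × N[ w ] ⊆ dominated (w′ ∷ hZ)) →
                suc j * 2 ≤ lValue Staller (w ∷ hL)
        reply lw (w′ , lw′ , N⊆) =
          staller-turn j (Z.unique-∷ uZ lw′) (L.unique-∷ uL lw)
            (∪-lub N⊆ (q⊆p∪q _ _ ∘ inv)) (Z.value-Dominator⁻ uZ c≤ lw′)

      staller-turn : ∀ j {hZ hL} → Unique hZ → Unique hL → dominated hL ⊆ dominated hZ →
                     suc (j * 2) ≤ zValue Staller hZ → suc j * 2 ≤ lValue Staller hL
      -- Only one more Z-move is guaranteed. Staller does not copy it; a vertex that it would newly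
      -- dominate is the one to play, and by `inv` it is undominated in the L-game too.
      staller-turn zero {hZ} {hL} uZ uL inv c≤
        with v , lv ← Z.legal-move Staller uZ c≤
        with x , _ , x∉ ← zLegal⁻ hZ lv = two-more-moves uL (x∉ ∘ inv)
      staller-turn (suc j) {hZ} {hL} uZ uL inv c≤
        with v , lv , c≤′ ← Z.value-Staller⁻ uZ c≤ =
        L.value-Staller⁺ uL lv′
          (dominator-turn j (Z.unique-∷ uZ lv) (L.unique-∷ uL lv′)
             (∪-lub (p⊆p∪q _) (q⊆p∪q _ _ ∘ inv)) c≤′)
        where lv′ = zLegal⇒lLegal hZ hL inv lv

    even-γZg⇒γZg<γLg : Fin n → ∀ q → γZg G ≡ q * 2 → suc (q * 2) ≤ γLg G
    -- Here a single L-move is enough, and at the start any vertex is legal because nothing is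
    -- dominated.
    even-γZg⇒γZg<γLg x zero    _  = L.value>0 Dominator [] (lLegal-undominated [] {x} ∉⊥)
    even-γZg⇒γZg<γLg _ (suc j) eq = dominator-turn j [] [] id (ℕ.≤-reflexive (sym eq))

theorem5p2 : (n : ℕ) → .{{_ : NonZero n}} → (G : Graph n) → IsolateFree G →
    2 ∣ γZg G → γZg G + 1 ≤ γLg G
theorem5p2 (suc _) G isolateFree (divides q eq) =
  subst (_≤ γLg G) (sym (trans (ℕ.+-comm (γZg G) 1) (cong suc eq)))
        (even-γZg⇒γZg<γLg G isolateFree zero q eq)
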